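{- Let $p$ be an odd prime. Any matrix $\begin{bmatrix} A & B \\ C & D \end{bmatrix}$ in $M_2(\mathbb{Z}_p)$ is a square or a sum of two squares of matrices in $M_2(\mathbb{Z}_p)$.
   Context: $\mathbb{Z}_p$ is the ring of $p$-adic integers and $M_2(\mathbb{Z}_p)$ is the ring of $2 \times 2$ matrices over $\mathbb{Z}_p$. -}

module Defs where

open import Algebra.Bundles using (CommutativeRing; Ring)
open import Data.Fin.Base using (Fin; zero; suc)
open import Data.Integer.Base as ℤ using (ℤ; +_; 0ℤ; 1ℤ)
open import Data.Integer.Divisibility.Signed
  using (_∣_; divides; ∣m∣n⇒∣m+n; ∣m⇒∣-m; ∣n⇒∣m*n; ∣m⇒∣m*n)
import Data.Integer.Properties as ℤ
open import Data.Integer.Tactic.RingSolver using (solve-∀)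
open import Data.Nat.Base using (ℕ; zero; suc; _^_)
open import Data.Product.Base using (_,_)
open import Level using (0ℓ)
open import Relation.Binary.PropositionalEquality.Core as ≡ using (_≡_; subst)
import Algebra.Properties.Semiring.Sum as Sum
import Relation.Binary.Reasoning.Setoid as SetoidReasoning

infix 4 _≡_[mod_]

-- This congruence and _≈ₚ_ are records so that their arguments can be inferred
-- from a proof.
record _≡_[mod_] (i j : ℤ) (m : ℕ) : Set where
  constructor mk≡
  field m∣i-j : + m ∣ i ℤ.- j

module _ {m : ℕ} where

  mod-reflexive : ∀ {i j} → i ≡ j → i ≡ j [mod m ]
  mod-reflexive {i} ≡.refl = mk≡ (divides 0ℤ (ℤ.+-inverseʳ i))

  mod-sym : ∀ {i j} → i ≡ j [mod m ] → j ≡ i [mod m ]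
  mod-sym {i} {j} (mk≡ e) = mk≡ (subst (+ m ∣_) (lemma i j) (∣m⇒∣-m e))
    where
    lemma : ∀ i j → ℤ.- (i ℤ.- j) ≡ j ℤ.- i
    lemma = solve-∀

  mod-trans : ∀ {i j k} → i ≡ j [mod m ] → j ≡ k [mod m ] → i ≡ k [mod m ]
  mod-trans {i} {j} {k} (mk≡ e) (mk≡ f) =
    mk≡ (subst (+ m ∣_) (lemma i j k) (∣m∣n⇒∣m+n e f))
    where
    lemma : ∀ i j k → (i ℤ.- j) ℤ.+ (j ℤ.- k) ≡ i ℤ.- k
    lemma = solve-∀

  mod-+ : ∀ {i j k l} → i ≡ j [mod m ] → k ≡ l [mod m ] →
          i ℤ.+ k ≡ j ℤ.+ l [mod m ]
  mod-+ {i} {j} {k} {l} (mk≡ e) (mk≡ f) =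
    mk≡ (subst (+ m ∣_) (lemma i j k l) (∣m∣n⇒∣m+n e f))
    where
    lemma : ∀ i j k l → (i ℤ.- j) ℤ.+ (k ℤ.- l) ≡ (i ℤ.+ k) ℤ.- (j ℤ.+ l)
    lemma = solve-∀

  mod-neg : ∀ {i j} → i ≡ j [mod m ] → ℤ.- i ≡ ℤ.- j [mod m ]
  mod-neg {i} {j} (mk≡ e) = mk≡ (subst (+ m ∣_) (lemma i j) (∣m⇒∣-m e))
    where
    lemma : ∀ i j → ℤ.- (i ℤ.- j) ≡ (ℤ.- i) ℤ.- (ℤ.- j)
    lemma = solve-∀

  mod-* : ∀ {i j k l} → i ≡ j [mod m ] → k ≡ l [mod m ] →
          i ℤ.* k ≡ j ℤ.* l [mod m ]
  mod-* {i} {j} {k} {l} (mk≡ e) (mk≡ f) =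
    mk≡ (subst (+ m ∣_) (lemma i j k l)
      (∣m∣n⇒∣m+n (∣m⇒∣m*n k e) (∣n⇒∣m*n j f)))
    where
    lemma : ∀ i j k l →
            (i ℤ.- j) ℤ.* k ℤ.+ j ℤ.* (k ℤ.- l) ≡ i ℤ.* k ℤ.- j ℤ.* l
    lemma = solve-∀

-- ℤ_p as the inverse limit of the rings ℤ/pⁿ.  The component in ℤ/pⁿ is given
-- by an integer representative, so equality of p-adic integers is the setoid
-- equality _≈ₚ_ rather than _≡_.
record PAdic (p : ℕ) : Set where
  constructor mkPAdic
  field
    residue  : ℕ → ℤ
    coherent : ∀ n → residue (suc n) ≡ residue n [mod p ^ n ]

open PAdic public

module _ (p : ℕ) where

  infix 4 _≈ₚ_

  record _≈ₚ_ (x y : PAdic p) : Set where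
    constructor mk≈
    field at : ∀ n → residue x n ≡ residue y n [mod p ^ n ]

  open _≈ₚ_ public

  private
    pointwise : ∀ {x y : PAdic p} → (∀ n → residue x n ≡ residue y n) → x ≈ₚ y
    pointwise e = mk≈ λ n → mod-reflexive (e n)

  ℤₚ : CommutativeRing 0ℓ 0ℓ
  ℤₚ = record
    { Carrier = PAdic p
    ; _≈_ = _≈ₚ_
    ; _+_ = λ x y → mkPAdic (λ n → residue x n ℤ.+ residue y n)
                            (λ n → mod-+ (coherent x n) (coherent y n))
    ; _*_ = λ x y → mkPAdic (λ n → residue x n ℤ.* residue y n)
                            (λ n → mod-* (coherent x n) (coherent y n))
    ; -_ = λ x → mkPAdic (λ n → ℤ.- residue x n) (λ n → mod-neg (coherent x n))
    ; 0# = mkPAdic (λ _ → 0ℤ) (λ _ → mod-reflexive ≡.refl)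
    ; 1# = mkPAdic (λ _ → 1ℤ) (λ _ → mod-reflexive ≡.refl)
    ; isCommutativeRing = record
      { isRing = record
        { +-isAbelianGroup = record
          { isGroup = record
            { isMonoid = record
              { isSemigroup = record
                { isMagma = record
                  { isEquivalence = record
                    { refl  = pointwise λ _ → ≡.refl
                    ; sym   = λ e → mk≈ λ n → mod-sym (at e n)
                    ; trans = λ e f → mk≈ λ n → mod-trans (at e n) (at f n)
                    }
                  ; ∙-cong = λ e f → mk≈ λ n → mod-+ (at e n) (at f n)
                  }
                ; assoc = λ x y z → pointwise λ n → ℤ.+-assoc (residue x n) _ _
                }
              ; identity = (λ x → pointwise λ n → ℤ.+-identityˡ _)
                         , (λ x → pointwise λ n → ℤ.+-identityʳ _)
              }
            ; inverse = (λ x → pointwise λ n → ℤ.+-inverseˡ (residue x n))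
                      , (λ x → pointwise λ n → ℤ.+-inverseʳ (residue x n))
            ; ⁻¹-cong = λ e → mk≈ λ n → mod-neg (at e n)
            }
          ; comm = λ x y → pointwise λ n → ℤ.+-comm (residue x n) _
          }
        ; *-cong = λ e f → mk≈ λ n → mod-* (at e n) (at f n)
        ; *-assoc = λ x y z → pointwise λ n → ℤ.*-assoc (residue x n) _ _
        ; *-identity = (λ x → pointwise λ n → ℤ.*-identityˡ _)
                     , (λ x → pointwise λ n → ℤ.*-identityʳ _)
        ; distrib = (λ x y z → pointwise λ n → ℤ.*-distribˡ-+ (residue x n) _ _)
                  , (λ x y z → pointwise λ n →
                      ℤ.*-distribʳ-+ (residue x n) (residue y n) (residue z n))
        }
      ; *-comm = λ x y → pointwise λ n → ℤ.*-comm (residue x n) _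
      }
    }

module _ {c ℓ} (n : ℕ) (R : Ring c ℓ) where

  open Ring R
  open Sum semiring
  open SetoidReasoning setoid

  private
    Mat : Set c
    Mat = Fin n → Fin n → Carrier

    δ : ∀ {k} → Fin k → Fin k → Carrier
    δ zero    zero    = 1#
    δ zero    (suc _) = 0#
    δ (suc _) zero    = 0#
    δ (suc i) (suc j) = δ i j

    sum-zero : ∀ {k} (f : Fin k → Carrier) → (∀ i → f i ≈ 0#) → sum f ≈ 0#
    sum-zero {k} f e = trans (sum-cong-≋ e) (sum-replicate-zero k)

    sum-δˡ : ∀ {k} (i : Fin k) f → ∑[ j < k ] (δ i j * f j) ≈ f i
    sum-δˡ zero    f = trans (+-cong (*-identityˡ _) (sum-zero (λ j → 0# * f (suc j)) λ _ → zeroˡ _))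
                             (+-identityʳ _)
    sum-δˡ (suc i) f = trans (+-cong (zeroˡ _) (sum-δˡ i (λ j → f (suc j)))) (+-identityˡ _)

    sum-δʳ : ∀ {k} (i : Fin k) f → ∑[ j < k ] (f j * δ j i) ≈ f i
    sum-δʳ zero    f = trans (+-cong (*-identityʳ _) (sum-zero (λ j → f (suc j) * 0#) λ _ → zeroʳ _))
                             (+-identityʳ _)
    sum-δʳ (suc i) f = trans (+-cong (zeroʳ _) (sum-δʳ i (λ j → f (suc j)))) (+-identityˡ _)

    _⊗_ : Mat → Mat → Mat
    (X ⊗ Y) i j = ∑[ k < n ] (X i k * Y k j)

    ⊗-assoc : ∀ X Y Z i j → ((X ⊗ Y) ⊗ Z) i j ≈ (X ⊗ (Y ⊗ Z)) i j
    ⊗-assoc X Y Z i j = begin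
      ∑[ k < n ] (∑[ l < n ] (X i l * Y l k) * Z k j)
        ≈⟨ sum-cong-≋ (λ k → *-distribʳ-sum (Z k j) (λ l → X i l * Y l k)) ⟩
      ∑[ k < n ] ∑[ l < n ] (X i l * Y l k * Z k j)
        ≈⟨ ∑-comm (λ k l → X i l * Y l k * Z k j) ⟩
      ∑[ l < n ] ∑[ k < n ] (X i l * Y l k * Z k j)
        ≈⟨ sum-cong-≋ (λ l → sum-cong-≋ λ k → *-assoc (X i l) (Y l k) (Z k j)) ⟩
      ∑[ l < n ] ∑[ k < n ] (X i l * (Y l k * Z k j))
        ≈⟨ sum-cong-≋ (λ l → *-distribˡ-sum (X i l) (λ k → Y l k * Z k j)) ⟨
      ∑[ l < n ] (X i l * ∑[ k < n ] (Y l k * Z k j)) ∎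

  matrixRing : Ring c ℓ
  matrixRing = record
    { Carrier = Mat
    ; _≈_ = λ X Y → ∀ i j → X i j ≈ Y i j
    ; _+_ = λ X Y i j → X i j + Y i j
    ; _*_ = _⊗_
    ; -_ = λ X i j → - X i j
    ; 0# = λ _ _ → 0#
    ; 1# = δ
    ; isRing = record
      { +-isAbelianGroup = record
        { isGroup = record
          { isMonoid = record
            { isSemigroup = record
              { isMagma = record
                { isEquivalence = record
                  { refl  = λ _ _ → refl
                  ; sym   = λ e i j → sym (e i j)
                  ; trans = λ e f i j → trans (e i j) (f i j)
                  }
                ; ∙-cong = λ e f i j → +-cong (e i j) (f i j)
                }
              ; assoc = λ _ _ _ _ _ → +-assoc _ _ _
              }
            ; identity = (λ _ _ _ → +-identityˡ _) , (λ _ _ _ → +-identityʳ _)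
            }
          ; inverse = (λ _ _ _ → -‿inverseˡ _) , (λ _ _ _ → -‿inverseʳ _)
          ; ⁻¹-cong = λ e i j → -‿cong (e i j)
          }
        ; comm = λ _ _ _ _ → +-comm _ _
        }
      ; *-cong = λ e f i j → sum-cong-≋ λ k → *-cong (e i k) (f k j)
      ; *-assoc = ⊗-assoc
      ; *-identity = (λ X i j → sum-δˡ i (λ k → X k j))
                   , (λ X i j → sum-δʳ j (X i))
      ; distrib =
          (λ X Y Z i j → trans
            (sum-cong-≋ λ k → distribˡ (X i k) (Y k j) (Z k j))
            (∑-distrib-+ (λ k → X i k * Y k j) (λ k → X i k * Z k j)))
        , (λ X Y Z i j → trans
            (sum-cong-≋ λ k → distribʳ (X k j) (Y i k) (Z i k))
            (∑-distrib-+ (λ k → Y i k * X k j) (λ k → Z i k * X k j)))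
      }
    }

M₂ : ∀ {c ℓ} → Ring c ℓ → Ring c ℓ
M₂ = matrixRing 2

{-# OPTIONS --safe #-}
-- Over any commutative ring in which 2 is invertible, every 2 × 2 matrix M is a
-- sum of two squares.  The square of [[a,b],[c,d]] with a + d = 1 has
-- off-diagonal entries b and c and diagonal difference a − d, so X can be chosen
-- such that M − X² is a scalar matrix s; and s is the square of [[0,s],[1,0]].
module Submission where

open import Defs
open import Algebra.Bundles using (CommutativeRing; Ring)
open import Data.Fin.Base using (zero; suc)
open import Data.Integer.Base as ℤ using (ℤ; +_; 1ℤ)
open import Data.Integer.Divisibility.Signed using (divides)
import Data.Integer.Properties as ℤ
import Data.Integer.Tactic.RingSolver as ℤ-Solver
open import Data.Nat.Base as ℕ using (ℕ; zero; suc; _^_)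
open import Data.Nat.Divisibility using (_∣_)
import Data.Nat.Divisibility as ℕ
open import Data.Nat.DivMod using (_/_; _%_; m≡m%n+[m/n]*n; m%n<n)
open import Data.Nat.Primality using (Prime)
open import Data.Product using (∃-syntax; _,_)
open import Data.Sum using (_⊎_; inj₂)
open import Relation.Binary.PropositionalEquality as ≡ using (_≡_)
open import Relation.Nullary using (¬_; contradiction)
import Algebra.Properties.Ring as RingProperties
import Algebra.Solver.Ring.NaturalCoefficients.Default as SemiringSolver
import Relation.Binary.Reasoning.Setoid as SetoidReasoning

module _ {c ℓ} (R : CommutativeRing c ℓ) where

  open CommutativeRing R hiding (zero)
  open RingProperties ring using (+-cancelʳ)
  open SemiringSolver commutativeSemiring using (solve; _:=_; _:+_; _:*_)
  open SetoidReasoning setoid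

  private
    module M₂R = Ring (M₂ ring)

  matrix : (a b c d : Carrier) → M₂R.Carrier
  matrix a b c d zero    zero    = a
  matrix a b c d zero    (suc _) = b
  matrix a b c d (suc _) zero    = c
  matrix a b c d (suc _) (suc _) = d

  matrix-* : ∀ a b c d a′ b′ c′ d′ →
             matrix a b c d M₂R.* matrix a′ b′ c′ d′ M₂R.≈
             matrix (a * a′ + b * c′) (a * b′ + b * d′)
                    (c * a′ + d * c′) (c * b′ + d * d′)
  -- A sum over `Fin 2` unfolds to `x + (y + 0#)`, so each entry only has to drop the trailing zero.
  matrix-* a b c d a′ b′ c′ d′ = λ where
    zero       zero       → +-congˡ (+-identityʳ _)
    zero       (suc zero) → +-congˡ (+-identityʳ _)
    (suc zero) zero       → +-congˡ (+-identityʳ _)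
    (suc zero) (suc zero) → +-congˡ (+-identityʳ _)

  -- The right-hand factor is the companion matrix of `t² − s`, so this is Cayley-Hamilton for it,
  -- checked entrywise.
  scalar-square : ∀ s → matrix s 0# 0# s M₂R.≈ matrix 0# s 1# 0# M₂R.* matrix 0# s 1# 0#
  scalar-square s = M₂R.trans entries (M₂R.sym (matrix-* 0# s 1# 0# 0# s 1# 0#))
    where
    entries : matrix s 0# 0# s M₂R.≈
              matrix (0# * 0# + s * 1#) (0# * s + s * 0#)
                     (1# * 0# + 0# * 1#) (1# * s + 0# * 0#)
    entries zero    zero    = sym (trans (+-cong (zeroˡ _) (*-identityʳ s)) (+-identityˡ s))
    entries zero    (suc _) = sym (trans (+-cong (zeroˡ _) (zeroʳ _)) (+-identityˡ 0#))
    entries (suc _) zero    = sym (trans (+-cong (zeroʳ _) (zeroˡ _)) (+-identityˡ 0#))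
    entries (suc _) (suc _) = sym (trans (+-cong (*-identityˡ s) (zeroˡ _)) (+-identityʳ s))

  -- The trace `a + d` factors out of both off-diagonal entries of the square and out of the
  -- difference of its diagonal entries. With trace one, the second hypothesis therefore matches the
  -- two diagonal differences, and the third settles the one diagonal entry left. Differences are
  -- written as sums to suit a semiring solver.
  square-+-scalar : ∀ M a d s →
    let B = M zero (suc zero) ; C = M (suc zero) zero in
    a + d ≈ 1# →
    M (suc zero) (suc zero) + a ≈ M zero zero + d →
    M zero zero ≈ a * a + B * C + s →
    M M₂R.≈ matrix a B C d M₂R.* matrix a B C d M₂R.+ matrix s 0# 0# s
  square-+-scalar M a d s a+d≈1 D+a≈A+d A≈ =
    M₂R.trans entries (M₂R.+-congʳ (M₂R.sym (matrix-* a B C d a B C d)))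
    where
    A = M zero zero
    B = M zero (suc zero)
    C = M (suc zero) zero
    D = M (suc zero) (suc zero)

    -- This is `d² − a² = (d − a)(a + d)` with every subtraction moved across; `b * c` and `s` occur
    -- on both sides.
    expand : ∀ a b c d s →
             (c * b + d * d + s) + a * (a + d) ≈ (a * a + b * c + s) + d * (a + d)
    expand = solve 5 (λ a b c d s →
      (c :* b :+ d :* d :+ s) :+ a :* (a :+ d) := (a :* a :+ b :* c :+ s) :+ d :* (a :+ d)) refl

    *-one : ∀ x → x * (a + d) ≈ x
    *-one x = trans (*-congˡ a+d≈1) (*-identityʳ x)

    upper-right : a * B + B * d ≈ B
    upper-right = trans (+-congʳ (*-comm a B)) (trans (sym (distribˡ B a d)) (*-one B))

    lower-left : C * a + d * C ≈ C
    lower-left = trans (+-congˡ (*-comm d C)) (trans (sym (distribˡ C a d)) (*-one C))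

    lower-right : C * B + d * d + s ≈ D
    lower-right = +-cancelʳ a _ _ (begin
      (C * B + d * d + s) + a            ≈⟨ +-congˡ (*-one a) ⟨
      (C * B + d * d + s) + a * (a + d)  ≈⟨ expand a B C d s ⟩
      (a * a + B * C + s) + d * (a + d)  ≈⟨ +-cong (sym A≈) (*-one d) ⟩
      A + d                              ≈⟨ D+a≈A+d ⟨
      D + a                              ∎)

    entries : M M₂R.≈ matrix (a * a + B * C) (a * B + B * d) (C * a + d * C) (C * B + d * d)
                      M₂R.+ matrix s 0# 0# s
    entries zero       zero       = A≈
    entries zero       (suc zero) = sym (trans (+-identityʳ _) upper-right)
    entries (suc zero) zero       = sym (trans (+-identityʳ _) lower-left)
    entries (suc zero) (suc zero) = sym lower-right

  module _ (½ : Carrier) (½+½≈1 : ½ + ½ ≈ 1#) where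

    sum-of-two-squares : ∀ M → ∃[ X ] ∃[ Y ] M M₂R.≈ X M₂R.* X M₂R.+ Y M₂R.* Y
    sum-of-two-squares M =
      matrix a B C d , matrix 0# s 1# 0# ,
      M₂R.trans (square-+-scalar M a d s (cancel 1# a) D+a≈A+d (sym (cancel A (a * a + B * C))))
                (M₂R.+-congˡ (scalar-square s))
      where
      A = M zero zero
      B = M zero (suc zero)
      C = M (suc zero) zero
      D = M (suc zero) (suc zero)
      -- `a` and `d` solve the linear system `a + d = 1`, `a − d = A − D`; `s` is what the upper
      -- left entry of the square still lacks.
      a = ½ * (1# + (A - D))
      d = 1# - a
      s = A - (a * a + B * C)

      cancel : ∀ x y → y + (x - y) ≈ x
      cancel x y = begin
        y + (x - y)    ≈⟨ +-comm y _ ⟩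
        x - y + y      ≈⟨ +-assoc x _ y ⟩
        x + (- y + y)  ≈⟨ +-congˡ (-‿inverseˡ y) ⟩
        x + 0#         ≈⟨ +-identityʳ x ⟩
        x              ∎

      a+a : a + a ≈ 1# + (A - D)
      a+a = trans (sym (distribʳ _ ½ ½)) (trans (*-congʳ ½+½≈1) (*-identityˡ _))

      rearrange : ∀ x y z → x + (y + z) ≈ y + (x + z)
      rearrange = solve 3 (λ x y z → x :+ (y :+ z) := y :+ (x :+ z)) refl

      D+a≈A+d : D + a ≈ A + d
      -- Adding `a` produces `a + a` on the left, where `½` disappears, and `a + d` on the right,
      -- which is 1; both sides become `A + 1#`.
      D+a≈A+d = +-cancelʳ a _ _ (begin
        D + a + a             ≈⟨ +-assoc D a a ⟩
        D + (a + a)           ≈⟨ +-congˡ a+a ⟩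
        D + (1# + (A - D))    ≈⟨ rearrange D 1# _ ⟩
        1# + (D + (A - D))    ≈⟨ +-congˡ (cancel A D) ⟩
        1# + A                ≈⟨ +-comm 1# A ⟩
        A + 1#                ≈⟨ +-congˡ (cancel 1# a) ⟨
        A + (a + d)           ≈⟨ +-congˡ (+-comm a d) ⟩
        A + (d + a)           ≈⟨ +-assoc A d a ⟨
        A + d + a             ∎)

odd⇒1+2k : ∀ n → ¬ (2 ∣ n) → ∃[ k ] n ≡ 1 ℕ.+ k ℕ.* 2
odd⇒1+2k n 2∤n with n % 2 in eq | m%n<n n 2 | m≡m%n+[m/n]*n n 2
... | 0 | _ | _  = contradiction (ℕ.m%n≡0⇒n∣m n 2 eq) 2∤n
... | 1 | _ | e  = n / 2 , e
... | suc (suc _) | ℕ.s≤s (ℕ.s≤s ()) | _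

module _ {p : ℕ} (k : ℕ) (p≡1+2k : p ≡ 1 ℕ.+ k ℕ.* 2) where

  open CommutativeRing (ℤₚ p) using (_≈_; _+_; 1#)

  -- The inverse of 2 modulo pⁿ is (pⁿ + 1) / 2, and consecutive ones differ by
  -- pⁿ (p − 1) / 2.
  halfResidue : ℕ → ℤ
  halfResidue zero    = 1ℤ
  halfResidue (suc n) = halfResidue n ℤ.+ + k ℤ.* + (p ^ n)

  -- An exact equation of integers rather than a congruence, so that it passes through the
  -- induction: the step adds `2k * p ^ n`, and `1 + 2k = p` turns `p ^ n` into the next power.
  halfResidue-double : ∀ n → halfResidue n ℤ.+ halfResidue n ≡ + (p ^ n) ℤ.+ 1ℤ
  halfResidue-double zero    = ≡.refl
  halfResidue-double (suc n) = begin
    (h ℤ.+ + k ℤ.* q) ℤ.+ (h ℤ.+ + k ℤ.* q)    ≡⟨ regroup h (+ k) q ⟩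
    (h ℤ.+ h) ℤ.+ + k ℤ.* + 2 ℤ.* q            ≡⟨ ≡.cong (ℤ._+ + k ℤ.* + 2 ℤ.* q) (halfResidue-double n) ⟩
    (q ℤ.+ 1ℤ) ℤ.+ + k ℤ.* + 2 ℤ.* q           ≡⟨ factor (+ k) q ⟩
    (1ℤ ℤ.+ + k ℤ.* + 2) ℤ.* q ℤ.+ 1ℤ          ≡⟨ ≡.cong (λ r → r ℤ.* q ℤ.+ 1ℤ) p-cast ⟨
    + p ℤ.* q ℤ.+ 1ℤ                           ≡⟨ ≡.cong (ℤ._+ 1ℤ) (ℤ.pos-* p (p ^ n)) ⟨
    + (p ^ suc n) ℤ.+ 1ℤ                       ∎
    where
    open ≡.≡-Reasoning
    h = halfResidue n
    q = + (p ^ n)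

    regroup : ∀ h k q → (h ℤ.+ k ℤ.* q) ℤ.+ (h ℤ.+ k ℤ.* q) ≡ (h ℤ.+ h) ℤ.+ k ℤ.* + 2 ℤ.* q
    regroup = ℤ-Solver.solve-∀

    factor : ∀ k q → (q ℤ.+ 1ℤ) ℤ.+ k ℤ.* + 2 ℤ.* q ≡ (1ℤ ℤ.+ k ℤ.* + 2) ℤ.* q ℤ.+ 1ℤ
    factor = ℤ-Solver.solve-∀

    p-cast : + p ≡ 1ℤ ℤ.+ + k ℤ.* + 2
    p-cast = ≡.trans (≡.cong +_ p≡1+2k) (≡.cong (λ j → 1ℤ ℤ.+ j) (ℤ.pos-* k 2))

  half : PAdic p
  -- Consecutive residues differ by exactly `+ k ℤ.* + (p ^ n)`, so the quotient is `+ k`.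
  half = mkPAdic halfResidue λ n → mk≡ (divides (+ k) (difference (halfResidue n) _))
    where
    difference : ∀ x y → (x ℤ.+ y) ℤ.- x ≡ y
    difference = ℤ-Solver.solve-∀

  half+half≈1 : half + half ≈ 1#
  -- The doubled residue exceeds 1 by exactly `p ^ n`, hence the quotient `1ℤ`.
  half+half≈1 = mk≈ λ n → mk≡ (divides 1ℤ (≡.trans
    (≡.cong (ℤ._- 1ℤ) (halfResidue-double n)) (difference (+ (p ^ n)))))
    where
    difference : ∀ x → (x ℤ.+ 1ℤ) ℤ.- 1ℤ ≡ 1ℤ ℤ.* x
    difference = ℤ-Solver.solve-∀

corollary2p4 : (p : ℕ) → Prime p → ¬ (2 ∣ p) →
    let open Ring (M₂ (CommutativeRing.ring (ℤₚ p))) in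
    (M : Carrier) →
    (∃[ X ] M ≈ X * X) ⊎ (∃[ X ] ∃[ Y ] M ≈ X * X + Y * Y)
corollary2p4 p _ 2∤p M =
  -- Oddness of `p` enters here: `k` yields the p-adic `half`, which serves as `½` in the
  -- construction over a commutative ring.
  let k , p≡1+2k = odd⇒1+2k p 2∤p
  in inj₂ (sum-of-two-squares (ℤₚ p) (half k p≡1+2k) (half+half≈1 k p≡1+2k) M)
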